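{- Let $q\geq 3$ be a prime power and let $(\mathcal{P},\mathcal{G},\mathcal{B})$ be a resolvable transversal design $\mathrm{TD}(q-1,q)$. Let $\mathcal{C}_{\mathrm{TD}}(q)$ be the combinatorial batch code whose servers are the points in $\mathcal{P}$ and whose items are the blocks in $\mathcal{B}$ together with the groups in $\mathcal{G}$, where an item is stored in exactly those servers that are the points it contains; it has parameters $n=q^2+q-1$, $N=q^3-q$, $k=q^2-q-1$, $m=q^2-q$. Then $\mathcal{C}_{\mathrm{TD}}(q)$ is an optimal CBC attaining the lower bound $$N(n,k,m)\geq ns-\left\lfloor\frac{(k-s)\left(\frac{(k-1)\binom{m}{s}}{\binom{k-1}{s}}-n\right)}{m-k+1}\right\rfloor$$ with $s=q$. That is, for these values of $n,k,m$, the least integer $s$ with $1\leq s\leq k-1$ and $n\leq (k-1)\binom{m}{s}/\binom{k-1}{s}$ is $s=q$, and $N=q^3-q=N(n,k,m)$ is equal to the right-hand side of the bound with $s=q$.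
   Context: An $(n,N,k,m)$-CBC (combinatorial batch code) consists of a set $\mathcal{S}$ of $m$ servers and $n$ items $x_1,\dots,x_n$, where item $x_j$ is stored in the servers of a subset $X_j\subseteq\mathcal{S}$, with total storage $\sum_{j=1}^n|X_j|=N$, such that any $k$ items can be retrieved by reading at most one item from each server; that is, for any $k$ distinct indices $i_1,\dots,i_k$ there exist pairwise distinct servers $s_1,\dots,s_k$ with $s_j\in X_{i_j}$ for all $j$. $N(n,k,m)$ denotes the minimal $N$ for which an $(n,N,k,m)$-CBC exists, and an $(n,N,k,m)$-CBC is optimal if $N=N(n,k,m)$. Known lower bound (from earlier literature): for $1\leq n\leq (k-1)\binom{m}{k-1}$, if $s$ is the least integer with $1\leq s\leq k-1$ such that $n\leq (k-1)\binom{m}{s}/\binom{k-1}{s}$, then the displayed inequality for $N(n,k,m)$ in the claim holds. A transversal design $\mathrm{TD}(\ell,h)$ is a triple $(\mathcal{P},\mathcal{G},\mathcal{B})$ where $\mathcal{P}$ is a set of $\ell h$ points; $\mathcal{G}$ is a partition of $\mathcal{P}$ into $\ell$ sets (groups), each of size $h$; $\mathcal{B}$ is a collection of $\ell$-subsets of $\mathcal{P}$ (blocks); each block meets each group in exactly one point; and any pair of points from different groups is contained in exactly one block. It is resolvable if $\mathcal{B}$ can be partitioned into $h$ sets (parallel classes), each containing $h$ blocks, such that each point is contained in exactly one block of each parallel class. -}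

module Defs where

open import Data.Fin.Base using (Fin)
open import Data.Fin.Subset using (Subset; ∣_∣; _∈_)
open import Data.Integer.Base as ℤ using (ℤ; +_)
open import Data.Nat.Base using (ℕ; zero; suc; _+_; _*_; _∸_; _^_; _≤_; s≤s; z≤n; NonZero; ≢-nonZero; ≢-nonZero⁻¹)
open import Data.Nat.Combinatorics using (_C_; nCn≡1; nCk≡nC[n∸k]; nCk+nC[k+1]≡[n+1]C[k+1])
open import Data.Nat.Primality using (Prime)
open import Data.Nat.Properties using (+-0-commutativeMonoid; m+n≡0⇒m≡0)
open import Data.Product using (Σ-syntax; ∃-syntax; ∃!; _×_)
open import Data.Rational.Base as ℚ using (ℚ; _/_; floor)
open import Data.Vec.Functional using (_++_)
open import Function.Definitions using (Injective)
open import Relation.Binary.PropositionalEquality using (_≡_; _≢_; subst; sym; trans)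

open import Algebra.Properties.CommutativeMonoid.Sum +-0-commutativeMonoid using (sum)

IsPrimePower : ℕ → Set
IsPrimePower q = ∃[ p ] ∃[ e ] (Prime p × 1 ≤ e × q ≡ p ^ e)

------------------------------------------------------------------------
-- Combinatorial batch codes

-- Servers and items are numbered; item j is stored in the servers of X j.
record StorageSystem : Set where
  field
    items   : ℕ
    servers : ℕ
    X       : Fin items → Subset servers

open StorageSystem public

storage : StorageSystem → ℕ
storage S = sum (λ j → ∣ X S j ∣)

Retrievable : ℕ → StorageSystem → Set
Retrievable k S =
  (i : Fin k → Fin (items S)) → Injective _≡_ _≡_ i →
  ∃[ s ] (Injective _≡_ _≡_ s × (∀ (j : Fin k) → s j ∈ X S (i j)))

record IsCBC (n N k m : ℕ) (S : StorageSystem) : Set where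
  field
    items≡n     : items S ≡ n
    storage≡N   : storage S ≡ N
    retrievable : Retrievable k S
    servers≡m   : servers S ≡ m

-- N = N(n,k,m).  This is a relation rather than a function because no code
-- exists for some n, k, m.
IsMinimalStorage : (n k m N : ℕ) → Set
IsMinimalStorage n k m N =
  (∃[ S ] IsCBC n N k m S) × (∀ N′ S → IsCBC n N′ k m S → N ≤ N′)

IsOptimalCBC : (n N k m : ℕ) → StorageSystem → Set
IsOptimalCBC n N k m S = IsCBC n N k m S × IsMinimalStorage n k m N

------------------------------------------------------------------------
-- The lower bound for N(n,k,m)

C-nonZero : ∀ {n k} → k ≤ n → NonZero (n C k)
C-nonZero {n} {zero} z≤n =
  subst NonZero (sym (trans (nCk≡nC[n∸k] {0} {n} z≤n) (nCn≡1 n))) _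
C-nonZero {suc n} {suc k} (s≤s k≤n) = ≢-nonZero λ eq →
  ≢-nonZero⁻¹ (n C k) {{C-nonZero k≤n}}
    (m+n≡0⇒m≡0 (n C k) (trans (nCk+nC[k+1]≡[n+1]C[k+1] n k) eq))

-- The rational number (k-1) (m choose s) / (k-1 choose s).
binomialRatio : (k m s : ℕ) → .(s ≤ k ∸ 1) → ℚ
binomialRatio k m s s≤k-1 =
  (+ ((k ∸ 1) * (m C s)) / ((k ∸ 1) C s)) {{C-nonZero s≤k-1}}

IsAdmissible : (n k m s : ℕ) → Set
IsAdmissible n k m s =
  1 ≤ s × (Σ[ s≤k-1 ∈ s ≤ k ∸ 1 ] (+ n / 1) ℚ.≤ binomialRatio k m s s≤k-1)

IsLeastAdmissible : (n k m s : ℕ) → Set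
IsLeastAdmissible n k m s =
  IsAdmissible n k m s × (∀ t → IsAdmissible n k m t → s ≤ t)

-- The denominator m - k + 1 is written suc (m ∸ k), so this is the intended
-- expression only for k ≤ m.
lowerBound : (n k m s : ℕ) → .(s ≤ k ∸ 1) → ℤ
lowerBound n k m s s≤k-1 =
  + (n * s) ℤ.-
  floor (((+ k ℤ.- + s) / 1)
         ℚ.* (binomialRatio k m s s≤k-1 ℚ.- (+ n / 1))
         ℚ.* (+ 1 / suc (m ∸ k)))

------------------------------------------------------------------------
-- Transversal designs

-- The parts P i are pairwise disjoint and cover all points.
IsPartition : ∀ {a v} → (Fin a → Subset v) → Set
IsPartition P = ∀ x → ∃! _≡_ (λ i → x ∈ P i)

record TransversalDesign (ℓ h : ℕ) : Set where
  field
    group            : Fin ℓ → Subset (ℓ * h)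
    group-partition  : IsPartition group
    group-size       : ∀ i → ∣ group i ∣ ≡ h
    #blocks          : ℕ
    block            : Fin #blocks → Subset (ℓ * h)
    block-injective  : Injective _≡_ _≡_ block
    block-size       : ∀ j → ∣ block j ∣ ≡ ℓ
    block-meets-once : ∀ j i → ∃! _≡_ (λ x → x ∈ block j × x ∈ group i)
    pair-in-one-block :
      ∀ {x y i i′} → x ∈ group i → y ∈ group i′ → i ≢ i′ →
      ∃! _≡_ (λ j → x ∈ block j × y ∈ block j)

record Resolvable {ℓ h : ℕ} (D : TransversalDesign ℓ h) : Set where
  open TransversalDesign D
  field
    parallelClass   : Fin h → Subset #blocks
    class-partition : IsPartition parallelClass
    class-size      : ∀ c → ∣ parallelClass c ∣ ≡ h
    point-once      :
      ∀ c x → ∃! _≡_ (λ j → j ∈ parallelClass c × x ∈ block j)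

-- Servers are the points; items are the blocks followed by the groups.  Blocks
-- have size ℓ and groups size h, so for ℓ ≢ h no block is also a group.
C-TD : ∀ {ℓ h} → TransversalDesign ℓ h → StorageSystem
C-TD {ℓ} {h} D = record
  { items   = #blocks + ℓ
  ; servers = ℓ * h
  ; X       = block ++ group
  }
  where open TransversalDesign D

{-# OPTIONS --safe #-}

-- Retrievability is Hall's condition: items whose servers all lie in a point
-- set Y must number at most |Y|.  Let Y meet the i-th group in a_i points.  A
-- block is determined by its points in two groups, so at most a_i a_j blocks lie
-- in Y for any i ≠ j; taking a_i, a_j to be the two smallest traces this suffices,
-- unless |Y| ≥ m − 1 = k.
--
-- For the lower bound, k = m − 1 means that any two servers are avoided by at most
-- k − 1 items.  Summing over ordered pairs of servers, with d_j = m − |X_j|, gives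
-- Σ d_j² − Σ d_j ≤ m (m − 1) (m − 2), and convexity turns this into a bound on
-- Σ d_j, that is, on the storage, which for these parameters is q³ − q.
module Submission where

open import Defs
open import Data.Bool.Base using (if_then_else_)
open import Data.Fin.Base using (Fin; zero; suc; punchIn; punchOut; splitAt)
open import Data.Fin.Properties as Fin using (_≟_; any?; all?)
open import Data.Fin.Subset
  using (Subset; inside; outside; ∣_∣; _∈_; _∉_; _⊆_; _∪_; _∩_; _─_; _-_; ⁅_⁆; ⊤)
  renaming (⊥ to ∅)
open import Data.Fin.Subset.Properties
open import Data.Integer.Base as ℤ using (ℤ)
import Data.Integer.Properties as ℤ
import Data.Integer.Tactic.RingSolver as ℤSolver
open import Data.Nat.Base hiding (∣_-_∣; _/_)
open import Data.Nat.Combinatorics using (_C_; nCk≡n!/k![n-k]!; k![n∸k]!∣n!)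
import Data.Nat.Coprimality as Coprimality
open import Data.Nat.DivMod using (m/n*n≡m; n/1≡n)
open import Data.Nat.Properties hiding (_≟_)
open import Data.Nat.Tactic.RingSolver using (solve-∀)
open import Data.Product using (Σ-syntax; ∃-syntax; ∃!; _×_; _,_; proj₁; proj₂)
open import Data.Rational.Base as ℚ using (ℚ; mkℚ; _/_; floor; toℚᵘ)
import Data.Rational.Properties as ℚ
open import Data.Rational.Unnormalised.Base as ℚᵘ using (mkℚᵘ; *≡*; *≤*)
import Data.Rational.Unnormalised.Properties as ℚᵘ
open import Data.Sum.Base using (_⊎_; inj₁; inj₂)
open import Data.Vec.Base using ([]; _∷_; here; there)
import Data.Vec.Functional as F
open import Data.Vec.Functional.Properties using (updateAt-updates; updateAt-minimal)
open import Function.Base using (_∘_; _$_; id)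
open import Function.Definitions using (Injective)
open import Relation.Binary.PropositionalEquality
  using (_≡_; _≢_; _≗_; refl; sym; trans; cong; cong₂; subst; subst₂; module ≡-Reasoning)
open import Relation.Nullary.Decidable using (Dec; yes; no; does; _×-dec_; _→-dec_; ¬?)
open import Relation.Nullary.Negation using (¬_; contradiction)

open import Algebra.Properties.CommutativeMonoid.Sum +-0-commutativeMonoid
  using (sum; sum-syntax; sum-cong-≗; sum-remove; ∑-distrib-+; ∑-comm)
open import Algebra.Properties.Semiring.Sum +-*-semiring
  using (*-distribˡ-sum; *-distribʳ-sum)

private variable
  m n k : ℕ
  P Q : Set

-- Sums and counting

sum-const : ∀ n c → ∑[ i < n ] c ≡ n * c
sum-const zero    c = refl
sum-const (suc n) c = cong (c +_) (sum-const n c)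

sum-mono-≤ : {f g : Fin n → ℕ} → (∀ i → f i ≤ g i) → sum f ≤ sum g
sum-mono-≤ {zero}  f≤g = z≤n
sum-mono-≤ {suc n} f≤g = +-mono-≤ (f≤g zero) (sum-mono-≤ (f≤g ∘ suc))

sum-mono-< : {f g : Fin n → ℕ} → (∀ i → f i ≤ g i) → (∃[ i ] f i < g i) → sum f < sum g
sum-mono-< f≤g (zero  , f<g) = +-mono-<-≤ f<g (sum-mono-≤ (f≤g ∘ suc))
sum-mono-< f≤g (suc i , f<g) = +-mono-≤-< (f≤g zero) (sum-mono-< (f≤g ∘ suc) (i , f<g))

sum-++ : (f : Fin m → ℕ) (g : Fin n → ℕ) → sum (f F.++ g) ≡ sum f + sum g
sum-++ {zero}  f g = refl
sum-++ {suc m} f g = trans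
  (cong (f zero +_) (trans (sum-cong-≗ (shift {m} f g)) (sum-++ (f ∘ suc) g)))
  (sym (+-assoc (f zero) _ _))
  where
  shift : ∀ {m n} (f : Fin (suc m) → ℕ) (g : Fin n → ℕ) → (f F.++ g) ∘ suc ≗ (f ∘ suc) F.++ g
  shift {m} f g i with splitAt m i
  ... | inj₁ _ = refl
  ... | inj₂ _ = refl

-- Induction on `k`: the entry at `i zero` is split off, and since the other values of `i` avoid it,
-- `punchOut` renumbers them into the remaining entries.
sum-injective : (f : Fin n → ℕ) {i : Fin k → Fin n} → Injective _≡_ _≡_ i →
                sum (f ∘ i) ≤ sum f
sum-injective {k = zero} f inj = z≤n
sum-injective {zero} {suc k} f {i} inj with i zero
... | ()
sum-injective {suc n} {suc k} f {i} inj = begin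
  f (i zero) + sum (f ∘ i ∘ suc)
    ≡⟨ cong (f (i zero) +_) (sum-cong-≗ λ j → cong f (sym (Fin.punchIn-punchOut (i₀≢ j)))) ⟩
  f (i zero) + sum (F.removeAt f (i zero) ∘ i′)
    ≤⟨ +-monoʳ-≤ (f (i zero)) (sum-injective (F.removeAt f (i zero)) inj′) ⟩
  f (i zero) + sum (F.removeAt f (i zero))
    ≡⟨ sum-remove {i = i zero} f ⟨
  sum f ∎
  where
  open ≤-Reasoning
  i₀≢ : ∀ j → i zero ≢ i (suc j)
  i₀≢ j eq with inj eq
  ... | ()
  i′ : Fin k → Fin n
  i′ j = punchOut (i₀≢ j)
  inj′ : Injective _≡_ _≡_ i′
  inj′ eq = Fin.suc-injective (inj (Fin.punchOut-injective (i₀≢ _) (i₀≢ _) eq))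

sum-*-sum : (f : Fin m → ℕ) (g : Fin n → ℕ) →
            sum f * sum g ≡ ∑[ x < m ] ∑[ y < n ] (f x * g y)
sum-*-sum f g = trans (*-distribʳ-sum (sum g) f) (sum-cong-≗ λ x → *-distribˡ-sum (f x) g)

argmin : (f : Fin (suc n) → ℕ) → ∃[ i ] (∀ j → f i ≤ f j)
argmin {zero}  f = zero , λ { zero → ≤-refl }
argmin {suc n} f with argmin (f ∘ suc)
... | i , min with ≤-total (f zero) (f (suc i))
...   | inj₁ f₀≤ = zero , λ { zero → ≤-refl ; (suc j) → ≤-trans f₀≤ (min j) }
...   | inj₂ ≤f₀ = suc i , λ { zero → ≤f₀ ; (suc j) → min j }

-- Cardinalities are written as sums of these indicators, so that double counting becomes an
-- exchange of sums.
𝟙 : Dec P → ℕ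
𝟙 d = if does d then 1 else 0

𝟙-yes : (d : Dec P) → P → 𝟙 d ≡ 1
𝟙-yes (yes _) p = refl
𝟙-yes (no ¬p) p = contradiction p ¬p

𝟙-no : (d : Dec P) → ¬ P → 𝟙 d ≡ 0
𝟙-no (yes p) ¬p = contradiction p ¬p
𝟙-no (no _)  ¬p = refl

𝟙-mono : (d : Dec P) (e : Dec Q) → (P → Q) → 𝟙 d ≤ 𝟙 e
𝟙-mono (no _)  e f = z≤n
𝟙-mono (yes p) e f = ≤-reflexive (sym (𝟙-yes e (f p)))

𝟙-× : (d : Dec P) (e : Dec Q) → 𝟙 (d ×-dec e) ≡ 𝟙 d * 𝟙 e
𝟙-× (yes _) (yes _) = refl
𝟙-× (yes _) (no _)  = refl
𝟙-× (no _)  _       = refl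

∣∣≡sum : (p : Subset n) → ∣ p ∣ ≡ ∑[ i < n ] 𝟙 (i ∈? p)
∣∣≡sum []            = refl
∣∣≡sum (inside  ∷ p) = cong suc (∣∣≡sum p)
∣∣≡sum (outside ∷ p) = ∣∣≡sum p

sum-unique : {P : Fin n → Set} (P? : ∀ i → Dec (P i)) → ∃! _≡_ P → ∑[ i < n ] 𝟙 (P? i) ≡ 1
sum-unique {suc n} P? (i , Pi , uniq) = begin
  sum (𝟙 ∘ P?)                              ≡⟨ sum-remove {i = i} (𝟙 ∘ P?) ⟩
  𝟙 (P? i) + ∑[ j < n ] 𝟙 (P? (punchIn i j))
    ≡⟨ cong₂ _+_ (𝟙-yes (P? i) Pi)
         (sum-cong-≗ λ j → 𝟙-no (P? (punchIn i j)) λ Pj → Fin.punchInᵢ≢i i j (sym (uniq Pj))) ⟩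
  1 + ∑[ j < n ] 0                          ≡⟨ cong suc (trans (sum-const n 0) (*-zeroʳ n)) ⟩
  1                                         ∎
  where open ≡-Reasoning

-- Extracts distinct indices from a lower bound on a count; this is how an impossible retrieval
-- request is produced.
sum≥⇒injection : {P : Fin n → Set} (P? : ∀ i → Dec (P i)) → k ≤ ∑[ i < n ] 𝟙 (P? i) →
                 Σ[ i ∈ (Fin k → Fin n) ] (Injective _≡_ _≡_ i × (∀ j → P (i j)))
sum≥⇒injection {k = zero} P? _ = (λ ()) , (λ {i} → λ { {()} }) , λ ()
sum≥⇒injection {suc n} {suc k} P? k≤ with P? zero
... | yes P0 with sum≥⇒injection (P? ∘ suc) (s≤s⁻¹ k≤)
...   | i , inj , Pi = (zero F.∷ (suc ∘ i)) , inj′ , λ { zero → P0 ; (suc j) → Pi j }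
  where
  inj′ : Injective _≡_ _≡_ (zero F.∷ (suc ∘ i))
  inj′ {zero}  {zero}  _  = refl
  inj′ {suc _} {suc _} eq = cong suc (inj (Fin.suc-injective eq))
sum≥⇒injection {suc n} {suc k} P? k≤ | no _ with sum≥⇒injection (P? ∘ suc) k≤
...   | i , inj , Pi = suc ∘ i , inj ∘ Fin.suc-injective , Pi

∣p∪q∣+∣p∩q∣≡∣p∣+∣q∣ : (p q : Subset n) → ∣ p ∪ q ∣ + ∣ p ∩ q ∣ ≡ ∣ p ∣ + ∣ q ∣
∣p∪q∣+∣p∩q∣≡∣p∣+∣q∣ []            []            = refl
∣p∪q∣+∣p∩q∣≡∣p∣+∣q∣ (inside  ∷ p) (inside  ∷ q) = cong suc $
  trans (+-suc _ _) (trans (cong suc (∣p∪q∣+∣p∩q∣≡∣p∣+∣q∣ p q)) (sym (+-suc _ _)))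
∣p∪q∣+∣p∩q∣≡∣p∣+∣q∣ (inside  ∷ p) (outside ∷ q) = cong suc (∣p∪q∣+∣p∩q∣≡∣p∣+∣q∣ p q)
∣p∪q∣+∣p∩q∣≡∣p∣+∣q∣ (outside ∷ p) (inside  ∷ q) =
  trans (cong suc (∣p∪q∣+∣p∩q∣≡∣p∣+∣q∣ p q)) (sym (+-suc _ _))
∣p∪q∣+∣p∩q∣≡∣p∣+∣q∣ (outside ∷ p) (outside ∷ q) = ∣p∪q∣+∣p∩q∣≡∣p∣+∣q∣ p q

x∈p─q⇒x∉q : ∀ {x} (p q : Subset n) → x ∈ p ─ q → x ∉ q
x∈p─q⇒x∉q (_ ∷ p) (outside ∷ q) (there x∈) (there x∈q) = x∈p─q⇒x∉q p q x∈ x∈q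
x∈p─q⇒x∉q (_ ∷ p) (inside  ∷ q) (there x∈) (there x∈q) = x∈p─q⇒x∉q p q x∈ x∈q

x∉p-x : (p : Subset n) (x : Fin n) → x ∉ p - x
x∉p-x p x x∈ = x∈p─q⇒x∉q p ⁅ x ⁆ x∈ (x∈⁅x⁆ x)

∣p∣≤1+∣p-x∣ : (p : Subset n) (x : Fin n) → ∣ p ∣ ≤ suc ∣ p - x ∣
∣p∣≤1+∣p-x∣ p x = begin
  ∣ p ∣                                             ≤⟨ p⊆q⇒∣p∣≤∣q∣ p⊆ ⟩
  ∣ ⁅ x ⁆ ∪ (p - x) ∣                               ≤⟨ m≤m+n _ _ ⟩
  ∣ ⁅ x ⁆ ∪ (p - x) ∣ + ∣ ⁅ x ⁆ ∩ (p - x) ∣         ≡⟨ ∣p∪q∣+∣p∩q∣≡∣p∣+∣q∣ ⁅ x ⁆ (p - x) ⟩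
  ∣ ⁅ x ⁆ ∣ + ∣ p - x ∣                             ≡⟨ cong (_+ ∣ p - x ∣) (∣⁅x⁆∣≡1 x) ⟩
  suc ∣ p - x ∣                                     ∎
  where
  open ≤-Reasoning
  p⊆ : p ⊆ ⁅ x ⁆ ∪ (p - x)
  p⊆ {y} y∈p with y ≟ x
  ... | yes refl = x∈p∪q⁺ (inj₁ (x∈⁅x⁆ x))
  ... | no y≢x   = x∈p∪q⁺ (inj₂ (x∈p∧x≢y⇒x∈p-y y∈p y≢x))

-- Hall's theorem, by Rado's edge deletion

Covers : (Fin n → Subset m) → Subset n → Subset m → Set
Covers X J Y = ∀ j → j ∈ J → X j ⊆ Y

-- `Y` ranges over all sets containing the `X j` with `j ∈ J`. Their union is the smallest such set,
-- so this is Hall's usual condition without forming unions of families.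
HallCondition : (Fin n → Subset m) → Set
HallCondition X = ∀ J Y → Covers X J Y → ∣ J ∣ ≤ ∣ Y ∣

Violation : (Fin n → Subset m) → Set
Violation X = ∃[ J ] ∃[ Y ] (Covers X J Y × ∣ Y ∣ < ∣ J ∣)

-- Finite search over all pairs `J`, `Y` makes the dichotomy constructive, with an explicit
-- violation on failure.
hallCondition? : (X : Fin n → Subset m) → Violation X ⊎ HallCondition X
hallCondition? X with
  anySubset? (λ J → anySubset? (λ Y →
    all? (λ j → (j ∈? J) →-dec (X j ⊆? Y)) ×-dec (∣ Y ∣ <? ∣ J ∣)))
... | yes v = inj₁ v
... | no ¬v = inj₂ λ J Y c → ≮⇒≥ λ lt → ¬v (J , Y , c , lt)

SDR : (Fin n → Subset m) → Set
SDR {n} {m} X = Σ[ s ∈ (Fin n → Fin m) ] (Injective _≡_ _≡_ s × (∀ j → s j ∈ X j))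

delete : (Fin n → Subset m) → Fin n → Fin m → Fin n → Subset m
delete X a x = F.updateAt X a (_- x)

delete-⊆ : (X : Fin n → Subset m) (a : Fin n) (x : Fin m) → ∀ j → delete X a x j ⊆ X j
delete-⊆ X a x j with j ≟ a
... | yes refl rewrite updateAt-updates a {_- x} X = p─q⊆p (X a) ⁅ x ⁆
... | no j≢a  rewrite updateAt-minimal j a {_- x} X j≢a = id

module _ {X : Fin n → Subset m} (hall : HallCondition X) {a : Fin n} where

  private
    at : ∀ {x J Y} → Covers (delete X a x) J Y → a ∈ J → X a - x ⊆ Y
    at {x} c a∈J = subst (_⊆ _) (updateAt-updates a {_- x} X) (c a a∈J)

    away : ∀ {x J Y} → Covers (delete X a x) J Y → ∀ {j} → j ∈ J → j ≢ a → X j ⊆ Y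
    away {x} c {j} j∈J j≢a = subst (_⊆ _) (updateAt-minimal j a {_- x} X j≢a) (c j j∈J)

    -- The deletion changes only the set at `a`, so a violation without `a` would already violate
    -- the Hall condition of `X`.
    violation-at : ∀ {x J Y} → Covers (delete X a x) J Y → ∣ Y ∣ < ∣ J ∣ → a ∈ J
    violation-at {x} {J} {Y} c lt with a ∈? J
    ... | yes a∈J = a∈J
    ... | no  a∉J = contradiction lt $ ≤⇒≯ $ hall J Y λ j j∈J →
      away {x} c j∈J λ { refl → a∉J j∈J }

  -- Both `J` and `K` contain `a`. As `x ≢ y`, all of `X a` lies in `Y ∪ Z`, which therefore covers
  -- `J ∪ K`, while `Y ∩ Z` covers `J ∩ K - a`. The Hall condition for these two pairs gives |J| +
  -- |K| - 1 ≤ |Y| + |Z| ≤ |J| + |K| - 2.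
  no-crossing-violations : ∀ {x y} → x ≢ y →
                           Violation (delete X a x) → ¬ Violation (delete X a y)
  no-crossing-violations {x} {y} x≢y (J , Y , cJ , Y<J) (K , Z , cK , Z<K) =
    n≮n (∣ J ∣ + ∣ K ∣) $ begin
      suc (∣ J ∣ + ∣ K ∣)                  ≡⟨ cong suc (∣p∪q∣+∣p∩q∣≡∣p∣+∣q∣ J K) ⟨
      suc (∣ J ∪ K ∣ + ∣ J ∩ K ∣)
        ≤⟨ s≤s (+-mono-≤ (hall (J ∪ K) (Y ∪ Z) union)
             (≤-trans (∣p∣≤1+∣p-x∣ (J ∩ K) a)
                      (s≤s (hall (J ∩ K - a) (Y ∩ Z) intersection)))) ⟩
      suc (∣ Y ∪ Z ∣ + suc ∣ Y ∩ Z ∣)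
        ≡⟨ trans (cong suc (+-suc _ _)) (cong (2 +_) (∣p∪q∣+∣p∩q∣≡∣p∣+∣q∣ Y Z)) ⟩
      2 + (∣ Y ∣ + ∣ Z ∣)                  ≡⟨ cong suc (+-suc _ _) ⟨
      suc ∣ Y ∣ + suc ∣ Z ∣                ≤⟨ +-mono-≤ Y<J Z<K ⟩
      ∣ J ∣ + ∣ K ∣                        ∎
    where
    open ≤-Reasoning
    union : Covers X (J ∪ K) (Y ∪ Z)
    union j j∈ w∈ with j ≟ a
    union j j∈ {w} w∈ | yes refl with w ≟ x
    -- The element `x`, deleted on the side of `J`, survives in `X a - y` and so lies in `Z`.
    ... | yes refl = x∈p∪q⁺ (inj₂ (at {y} cK (violation-at {y} cK Z<K) (x∈p∧x≢y⇒x∈p-y w∈ x≢y)))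
    ... | no  w≢x  = x∈p∪q⁺ (inj₁ (at {x} cJ (violation-at {x} cJ Y<J) (x∈p∧x≢y⇒x∈p-y w∈ w≢x)))
    union j j∈ w∈ | no j≢a with x∈p∪q⁻ J K j∈
    ... | inj₁ j∈J = x∈p∪q⁺ (inj₁ (away {x} cJ j∈J j≢a w∈))
    ... | inj₂ j∈K = x∈p∪q⁺ (inj₂ (away {y} cK j∈K j≢a w∈))

    intersection : Covers X (J ∩ K - a) (Y ∩ Z)
    intersection j j∈ w∈ = x∈p∩q⁺ (away {x} cJ j∈J j≢a w∈ , away {y} cK j∈K j≢a w∈)
      where
      j∈J×j∈K = x∈p∩q⁻ J K (p─q⊆p (J ∩ K) ⁅ a ⁆ j∈)
      j∈J = proj₁ j∈J×j∈K
      j∈K = proj₂ j∈J×j∈K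
      j≢a : j ≢ a
      j≢a refl = x∉p-x (J ∩ K) a j∈

-- The Hall condition for one index gives nonemptiness, and for two indices it makes their unique
-- elements distinct.
singletons-SDR : (X : Fin n → Subset m) → HallCondition X →
                 (∀ {j x y} → x ∈ X j → y ∈ X j → x ≡ y) → SDR X
singletons-SDR {n} {m} X hall single = s , s-inj , s∈
  where
  open ≤-Reasoning
  s∃ : ∀ j → ∃[ x ] x ∈ X j
  s∃ j with nonempty? (X j)
  ... | yes ne = ne
  ... | no ¬ne = contradiction (hall ⁅ j ⁆ ∅ λ i i∈ x∈ →
          contradiction (_ , subst (λ l → _ ∈ X l) (x∈⁅y⁆⇒x≡y j i∈) x∈) ¬ne)
        (<⇒≱ (subst₂ _<_ (sym (∣⊥∣≡0 m)) (sym (∣⁅x⁆∣≡1 j)) z<s))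
  s : Fin n → Fin m
  s = proj₁ ∘ s∃
  s∈ : ∀ j → s j ∈ X j
  s∈ = proj₂ ∘ s∃
  s-inj : Injective _≡_ _≡_ s
  s-inj {i} {j} si≡sj with i ≟ j
  ... | yes i≡j = i≡j
  ... | no  i≢j = contradiction (hall J ⁅ s j ⁆ cov) (<⇒≱ 1<2)
    where
    J = ⁅ i ⁆ ∪ ⁅ j ⁆
    cov : Covers X J ⁅ s j ⁆
    cov l l∈ {x} x∈ with x∈p∪q⁻ ⁅ i ⁆ ⁅ j ⁆ l∈
    ... | inj₁ l∈i rewrite x∈⁅y⁆⇒x≡y i l∈i | single x∈ (s∈ i) | si≡sj = x∈⁅x⁆ (s j)
    ... | inj₂ l∈j rewrite x∈⁅y⁆⇒x≡y j l∈j | single x∈ (s∈ j) = x∈⁅x⁆ (s j)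
    j⊆ : ⁅ j ⁆ ⊆ J - i
    j⊆ {l} l∈ = x∈p∧x≢y⇒x∈p-y (q⊆p∪q ⁅ i ⁆ ⁅ j ⁆ l∈)
                  λ l≡i → i≢j (trans (sym l≡i) (x∈⁅y⁆⇒x≡y j l∈))
    1<2 : ∣ ⁅ s j ⁆ ∣ < ∣ J ∣
    1<2 = begin-strict
      ∣ ⁅ s j ⁆ ∣  ≡⟨ trans (∣⁅x⁆∣≡1 (s j)) (sym (∣⁅x⁆∣≡1 j)) ⟩
      ∣ ⁅ j ⁆ ∣    ≤⟨ p⊆q⇒∣p∣≤∣q∣ j⊆ ⟩
      ∣ J - i ∣    <⟨ x∈p⇒∣p-x∣<∣p∣ (p⊆p∪q ⁅ j ⁆ (x∈⁅x⁆ i)) ⟩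
      ∣ J ∣        ∎

-- While some set has two elements, one of the two deletions keeps the Hall condition, and
-- representatives of the smaller family also serve for `X`.
hall-theorem : (X : Fin n → Subset m) → HallCondition X → SDR X
hall-theorem {n} {m} X = go (suc (total X)) X ≤-refl
  where
  total : (Fin n → Subset m) → ℕ
  total X = ∑[ j < n ] ∣ X j ∣

  delete-< : ∀ X {a x} → x ∈ X a → total (delete X a x) < total X
  delete-< X {a} {x} x∈ = sum-mono-< (λ j → p⊆q⇒∣p∣≤∣q∣ (delete-⊆ X a x j))
    (a , subst (λ p → ∣ p ∣ < ∣ X a ∣) (sym (updateAt-updates a {_- x} X)) (x∈p⇒∣p-x∣<∣p∣ x∈))

  -- The strict bound `b` on the total size makes the recursion structural.
  go : ∀ b X → total X < b → HallCondition X → SDR X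
  go (suc b) X lt hall with
    any? (λ a → any? (λ x → any? (λ y → (x ∈? X a) ×-dec (y ∈? X a) ×-dec ¬? (x ≟ y))))
  ... | no ¬two = singletons-SDR X hall single
    where
    single : ∀ {j x y} → x ∈ X j → y ∈ X j → x ≡ y
    single {j} {x} {y} x∈ y∈ with x ≟ y
    ... | yes x≡y = x≡y
    ... | no  x≢y = contradiction (j , x , y , x∈ , y∈ , x≢y) ¬two
  ... | yes (a , x , y , x∈ , y∈ , x≢y) =
    case-split (hallCondition? (delete X a x)) (hallCondition? (delete X a y))
    where
    descend : ∀ {z} → z ∈ X a → HallCondition (delete X a z) → SDR X
    descend {z} z∈ h with go b (delete X a z) (<-≤-trans (delete-< X z∈) (s≤s⁻¹ lt)) h
    ... | s , inj , s∈ = s , inj , λ j → delete-⊆ X a z j (s∈ j)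
    case-split : Violation (delete X a x) ⊎ HallCondition (delete X a x) →
                 Violation (delete X a y) ⊎ HallCondition (delete X a y) → SDR X
    case-split (inj₂ h) _        = descend x∈ h
    case-split (inj₁ _) (inj₂ h) = descend y∈ h
    case-split (inj₁ v) (inj₁ w) = contradiction w (no-crossing-violations hall x≢y v)

-- Counting blocks and groups of a transversal design

module _ {ℓ h : ℕ} (D : TransversalDesign ℓ h) where
  open TransversalDesign D

  inGroup? : ∀ (Y : Subset (ℓ * h)) i x → Dec (x ∈ Y × x ∈ group i)
  inGroup? Y i x = (x ∈? Y) ×-dec (x ∈? group i)

  -- The number a_i of points in which `Y` meets the i-th group.
  trace : Subset (ℓ * h) → Fin ℓ → ℕ
  trace Y i = ∑[ x < ℓ * h ] 𝟙 (inGroup? Y i x)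

  -- After the sums are exchanged, each point of `Y` is counted once because it lies in exactly one
  -- group.
  sum-trace : ∀ Y → ∑[ i < ℓ ] trace Y i ≡ ∣ Y ∣
  sum-trace Y = begin
    ∑[ i < ℓ ] ∑[ x < ℓ * h ] 𝟙 (inGroup? Y i x)
      ≡⟨ ∑-comm (λ i x → 𝟙 (inGroup? Y i x)) ⟩
    ∑[ x < ℓ * h ] ∑[ i < ℓ ] 𝟙 (inGroup? Y i x)
      ≡⟨ sum-cong-≗ (λ x → sum-cong-≗ λ i → 𝟙-× (x ∈? Y) (x ∈? group i)) ⟩
    ∑[ x < ℓ * h ] ∑[ i < ℓ ] (𝟙 (x ∈? Y) * 𝟙 (x ∈? group i))
      ≡⟨ sum-cong-≗ (λ x → *-distribˡ-sum (𝟙 (x ∈? Y)) (λ i → 𝟙 (x ∈? group i))) ⟨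
    ∑[ x < ℓ * h ] (𝟙 (x ∈? Y) * ∑[ i < ℓ ] 𝟙 (x ∈? group i))
      ≡⟨ sum-cong-≗ (λ x → trans
           (cong (𝟙 (x ∈? Y) *_) (sum-unique (λ i → x ∈? group i) (group-partition x)))
           (*-identityʳ _)) ⟩
    ∑[ x < ℓ * h ] 𝟙 (x ∈? Y)
      ≡⟨ ∣∣≡sum Y ⟨
    ∣ Y ∣ ∎
    where open ≡-Reasoning

  trace-≤ : ∀ Y i → trace Y i ≤ h
  trace-≤ Y i = begin
    trace Y i                          ≤⟨ sum-mono-≤ (λ x → 𝟙-mono (inGroup? Y i x) (x ∈? group i) proj₂) ⟩
    ∑[ x < ℓ * h ] 𝟙 (x ∈? group i)    ≡⟨ ∣∣≡sum (group i) ⟨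
    ∣ group i ∣                        ≡⟨ group-size i ⟩
    h                                  ∎
    where open ≤-Reasoning

  trace-full : ∀ {Y i} → group i ⊆ Y → trace Y i ≡ h
  trace-full {Y} {i} G⊆Y = ≤-antisym (trace-≤ Y i) $ begin
    h                                  ≡⟨ group-size i ⟨
    ∣ group i ∣                        ≡⟨ ∣∣≡sum (group i) ⟩
    ∑[ x < ℓ * h ] 𝟙 (x ∈? group i)
      ≤⟨ sum-mono-≤ (λ x → 𝟙-mono (x ∈? group i) (inGroup? Y i x) λ x∈ → G⊆Y x∈ , x∈) ⟩
    trace Y i                          ∎
    where open ≤-Reasoning

  blockTrace : Subset (ℓ * h) → Fin #blocks → Fin ℓ → ℕ
  blockTrace Y j i = ∑[ x < ℓ * h ] 𝟙 (inGroup? Y i x ×-dec (x ∈? block j))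

  blockTrace≡1 : ∀ {Y j} i → block j ⊆ Y → blockTrace Y j i ≡ 1
  blockTrace≡1 {Y} {j} i B⊆Y with block-meets-once j i
  ... | x , (x∈B , x∈G) , uniq =
    sum-unique (λ x → inGroup? Y i x ×-dec (x ∈? block j))
      (x , ((B⊆Y x∈B , x∈G) , x∈B) , λ { ((_ , y∈G) , y∈B) → uniq (y∈B , y∈G) })

  -- Both sides count triples of a block and two of its points in `Y`, one in each of the two
  -- groups: such a pair of points determines the block.
  sum-blockTraces : ∀ Y {i i′} → i ≢ i′ →
    ∑[ j < #blocks ] (blockTrace Y j i * blockTrace Y j i′) ≡ trace Y i * trace Y i′
  sum-blockTraces Y {i} {i′} i≢i′ = begin
    ∑[ j < #blocks ] (blockTrace Y j i * blockTrace Y j i′)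
      ≡⟨ sum-cong-≗ (λ j → sum-*-sum (a i j) (a i′ j)) ⟩
    ∑[ j < #blocks ] ∑[ x < ℓ * h ] ∑[ y < ℓ * h ] (a i j x * a i′ j y)
      ≡⟨ ∑-comm (λ j x → ∑[ y < ℓ * h ] (a i j x * a i′ j y)) ⟩
    ∑[ x < ℓ * h ] ∑[ j < #blocks ] ∑[ y < ℓ * h ] (a i j x * a i′ j y)
      ≡⟨ sum-cong-≗ (λ x → ∑-comm (λ j y → a i j x * a i′ j y)) ⟩
    ∑[ x < ℓ * h ] ∑[ y < ℓ * h ] ∑[ j < #blocks ] (a i j x * a i′ j y)
      ≡⟨ sum-cong-≗ (λ x → sum-cong-≗ (through x)) ⟩
    ∑[ x < ℓ * h ] ∑[ y < ℓ * h ] (𝟙 (inGroup? Y i x) * 𝟙 (inGroup? Y i′ y))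
      ≡⟨ sum-*-sum (λ x → 𝟙 (inGroup? Y i x)) (λ y → 𝟙 (inGroup? Y i′ y)) ⟨
    trace Y i * trace Y i′ ∎
    where
    open ≡-Reasoning
    a : Fin ℓ → Fin #blocks → Fin (ℓ * h) → ℕ
    a i j x = 𝟙 (inGroup? Y i x ×-dec (x ∈? block j))
    through : ∀ x y → ∑[ j < #blocks ] (a i j x * a i′ j y) ≡ 𝟙 (inGroup? Y i x) * 𝟙 (inGroup? Y i′ y)
    through x y = begin
      ∑[ j < #blocks ] (a i j x * a i′ j y)
        ≡⟨ sum-cong-≗ (λ j → cong₂ _*_ (𝟙-× (inGroup? Y i x) (x ∈? block j))
                                       (𝟙-× (inGroup? Y i′ y) (y ∈? block j))) ⟩
      ∑[ j < #blocks ] ((u * 𝟙 (x ∈? block j)) * (v * 𝟙 (y ∈? block j)))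
        ≡⟨ sum-cong-≗ (λ j → trans (*-interchange u _ v _)
             (cong (u * v *_) (sym (𝟙-× (x ∈? block j) (y ∈? block j))))) ⟩
      ∑[ j < #blocks ] (u * v * 𝟙 ((x ∈? block j) ×-dec (y ∈? block j)))
        ≡⟨ *-distribˡ-sum (u * v) (λ j → 𝟙 ((x ∈? block j) ×-dec (y ∈? block j))) ⟨
      u * v * joint
        ≡⟨ absorb (inGroup? Y i x) (inGroup? Y i′ y) ⟩
      u * v ∎
      where
      u = 𝟙 (inGroup? Y i x)
      v = 𝟙 (inGroup? Y i′ y)
      joint = ∑[ j < #blocks ] 𝟙 ((x ∈? block j) ×-dec (y ∈? block j))
      *-interchange : ∀ a b c d → a * b * (c * d) ≡ a * c * (b * d)
      *-interchange = solve-∀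
      absorb : (d : Dec (x ∈ Y × x ∈ group i)) (e : Dec (y ∈ Y × y ∈ group i′)) →
               𝟙 d * 𝟙 e * joint ≡ 𝟙 d * 𝟙 e
      absorb (no _)  _      = refl
      absorb (yes _) (no _) = refl
      absorb (yes (_ , x∈G)) (yes (_ , y∈G)) = trans (*-identityˡ joint)
        (sum-unique (λ j → (x ∈? block j) ×-dec (y ∈? block j))
                    (pair-in-one-block x∈G y∈G i≢i′))

  -- A block inside `Y` contributes exactly 1 to the sum in `sum-blockTraces`.
  blocks-inside-≤ : ∀ Y {i i′} → i ≢ i′ →
    ∑[ j < #blocks ] 𝟙 (block j ⊆? Y) ≤ trace Y i * trace Y i′
  blocks-inside-≤ Y {i} {i′} i≢i′ = begin
    ∑[ j < #blocks ] 𝟙 (block j ⊆? Y)                       ≤⟨ sum-mono-≤ inside-≤ ⟩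
    ∑[ j < #blocks ] (blockTrace Y j i * blockTrace Y j i′) ≡⟨ sum-blockTraces Y i≢i′ ⟩
    trace Y i * trace Y i′                                  ∎
    where
    open ≤-Reasoning
    inside-≤ : ∀ j → 𝟙 (block j ⊆? Y) ≤ blockTrace Y j i * blockTrace Y j i′
    inside-≤ j with block j ⊆? Y
    ... | no _ = z≤n
    ... | yes B⊆Y = ≤-reflexive (sym (cong₂ _*_ (blockTrace≡1 i B⊆Y) (blockTrace≡1 i′ B⊆Y)))

  -- The count of `sum-blockTraces` with `Y` the set of all points.
  #blocks≡h*h : {i i′ : Fin ℓ} → i ≢ i′ → #blocks ≡ h * h
  #blocks≡h*h {i} {i′} i≢i′ = begin
    #blocks                                                 ≡⟨ *-identityʳ #blocks ⟨
    #blocks * 1                                             ≡⟨ sum-const #blocks 1 ⟨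
    ∑[ j < #blocks ] 1
      ≡⟨ sum-cong-≗ (λ j → cong₂ _*_ (blockTrace≡1 {⊤} {j} i (⊆-max _))
                                     (blockTrace≡1 {⊤} {j} i′ (⊆-max _))) ⟨
    ∑[ j < #blocks ] (blockTrace ⊤ j i * blockTrace ⊤ j i′) ≡⟨ sum-blockTraces ⊤ i≢i′ ⟩
    trace ⊤ i * trace ⊤ i′
      ≡⟨ cong₂ _*_ (trace-full {⊤} (⊆-max _)) (trace-full {⊤} (⊆-max _)) ⟩
    h * h                                                   ∎
    where open ≡-Reasoning

  storage-C-TD : storage (C-TD D) ≡ #blocks * ℓ + ℓ * h
  storage-C-TD = begin
    sum (λ j → ∣ (block F.++ group) j ∣)          ≡⟨ sum-cong-≗ push ⟩
    sum ((∣_∣ ∘ block) F.++ (∣_∣ ∘ group))        ≡⟨ sum-++ (∣_∣ ∘ block) (∣_∣ ∘ group) ⟩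
    sum (∣_∣ ∘ block) + sum (∣_∣ ∘ group)
      ≡⟨ cong₂ _+_ (sum-cong-≗ block-size) (sum-cong-≗ group-size) ⟩
    ∑[ j < #blocks ] ℓ + ∑[ i < ℓ ] h             ≡⟨ cong₂ _+_ (sum-const #blocks ℓ) (sum-const ℓ h) ⟩
    #blocks * ℓ + ℓ * h                           ∎
    where
    open ≡-Reasoning
    push : ∀ j → ∣ (block F.++ group) j ∣ ≡ ((∣_∣ ∘ block) F.++ (∣_∣ ∘ group)) j
    push j with splitAt #blocks j
    ... | inj₁ _ = refl
    ... | inj₂ _ = refl

  items-inside : ∀ Y → ∑[ t < #blocks + ℓ ] 𝟙 ((block F.++ group) t ⊆? Y) ≡
                 ∑[ j < #blocks ] 𝟙 (block j ⊆? Y) + ∑[ i < ℓ ] 𝟙 (group i ⊆? Y)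
  items-inside Y = trans (sum-cong-≗ push)
    (sum-++ (λ j → 𝟙 (block j ⊆? Y)) (λ i → 𝟙 (group i ⊆? Y)))
    where
    push : ∀ t → 𝟙 ((block F.++ group) t ⊆? Y) ≡
                 ((λ j → 𝟙 (block j ⊆? Y)) F.++ (λ i → 𝟙 (group i ⊆? Y))) t
    push t with splitAt #blocks t
    ... | inj₁ _ = refl
    ... | inj₂ _ = refl

-- Let α ≤ β be the two smallest values of f.  Then w ≤ α β, and away from the
-- minimum f − e ≥ min(β, 2 + p); this gives the first alternative unless
-- α ≥ 2 + p and β = 3 + p.
weight-≤-sum : ∀ p {w} (f e : Fin (2 + p) → ℕ) →
  (∀ i → f i ≤ 3 + p) →
  (∀ i → e i ≡ 0 ⊎ (e i ≡ 1 × f i ≡ 3 + p)) →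
  (∀ {i j} → i ≢ j → w ≤ f i * f j) →
  w + sum e ≤ sum f ⊎ (2 + p) + (1 + p) * (3 + p) ≤ sum f
weight-≤-sum p {w} f e f≤ e∈ w≤ = cases (β ≤? 2 + p) (α ≤? 1 + p)
  where
  open ≤-Reasoning
  i₀ = proj₁ (argmin f)
  α  = f i₀
  f′ = F.removeAt f i₀
  e′ = F.removeAt e i₀
  i₁ = proj₁ (argmin f′)
  β  = f′ i₁
  α≤β : α ≤ β
  α≤β = proj₂ (argmin f) (punchIn i₀ i₁)
  w≤αβ : w ≤ α * β
  w≤αβ = w≤ (λ eq → Fin.punchInᵢ≢i i₀ i₁ (sym eq))

  e₀≡0 : α ≤ 2 + p → e i₀ ≡ 0
  e₀≡0 α≤ with e∈ i₀
  ... | inj₁ e≡0 = e≡0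
  ... | inj₂ (_ , α≡) = contradiction (≤-trans (≤-reflexive (sym α≡)) α≤) (n≮n (2 + p))

  -- Where `e` is 1, the value of `f` is 3 + p, leaving room for `c ≤ 2 + p`; elsewhere `f` is at
  -- least β.
  e+c≤f : ∀ {c} → c ≤ 2 + p → c ≤ β → ∀ j → e′ j + c ≤ f′ j
  e+c≤f {c} c≤ c≤β j with e∈ (punchIn i₀ j)
  ... | inj₁ e≡0 rewrite e≡0 = ≤-trans c≤β (proj₂ (argmin f′) j)
  ... | inj₂ (e≡1 , f≡) rewrite e≡1 | f≡ = s≤s c≤

  conclude : ∀ c → c ≤ 2 + p → c ≤ β → α ≤ 2 + p → w ≤ α + (1 + p) * c → w + sum e ≤ sum f
  conclude c c≤ c≤β α≤ w≤c = begin
    w + sum e                          ≡⟨ cong (w +_) (sum-remove {i = i₀} e) ⟩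
    w + (e i₀ + sum e′)                ≡⟨ cong (λ z → w + (z + sum e′)) (e₀≡0 α≤) ⟩
    w + sum e′                         ≤⟨ +-monoˡ-≤ (sum e′) w≤c ⟩
    α + (1 + p) * c + sum e′           ≡⟨ reorder α ((1 + p) * c) (sum e′) ⟩
    α + (sum e′ + (1 + p) * c)         ≡⟨ cong (λ z → α + (sum e′ + z)) (sum-const (1 + p) c) ⟨
    α + (sum e′ + ∑[ j < 1 + p ] c)    ≡⟨ cong (α +_) (∑-distrib-+ e′ (λ _ → c)) ⟨
    α + ∑[ j < 1 + p ] (e′ j + c)      ≤⟨ +-monoʳ-≤ α (sum-mono-≤ (e+c≤f c≤ c≤β)) ⟩
    α + sum f′                         ≡⟨ sum-remove {i = i₀} f ⟨
    sum f                              ∎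
    where
    reorder : ∀ a b c → a + b + c ≡ a + (c + b)
    reorder = solve-∀

  cases : Dec (β ≤ 2 + p) → Dec (α ≤ 1 + p) →
          w + sum e ≤ sum f ⊎ (2 + p) + (1 + p) * (3 + p) ≤ sum f
  cases (yes β≤) _ = inj₁ (conclude β β≤ ≤-refl (≤-trans α≤β β≤) (≤-trans w≤αβ (αβ≤ α≤β β≤)))
    where
    αβ≤ : ∀ {α β} → α ≤ β → β ≤ 2 + p → α * β ≤ α + (1 + p) * β
    αβ≤ {α} {zero}  _   _   = ≤-trans (≤-reflexive (*-zeroʳ α)) z≤n
    αβ≤ {α} {suc b} α≤β β≤ = begin
      α * suc b            ≡⟨ *-suc α b ⟩
      -- Here α ≤ β bounds the first factor, and `b`, which is β - 1, is at most 1 + p.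
      α + α * b            ≤⟨ +-monoʳ-≤ α (*-mono-≤ α≤β (s≤s⁻¹ β≤)) ⟩
      α + suc b * (1 + p)  ≡⟨ cong (α +_) (*-comm (suc b) (1 + p)) ⟩
      α + (1 + p) * suc b  ∎
  cases (no β≰) (yes α≤) = inj₁ (conclude (2 + p) ≤-refl (<⇒≤ (≰⇒> β≰)) (m≤n⇒m≤1+n α≤) (begin
    w                          ≤⟨ w≤αβ ⟩
    α * β                      ≤⟨ *-monoʳ-≤ α (f≤ (punchIn i₀ i₁)) ⟩
    α * (3 + p)                ≡⟨ *-suc α (2 + p) ⟩
    α + α * (2 + p)            ≤⟨ +-monoʳ-≤ α (*-monoˡ-≤ (2 + p) α≤) ⟩
    α + (1 + p) * (2 + p)      ∎))
  -- Now α ≥ 2 + p and every other value is at least 3 + p, so the sum is at least m - 1.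
  cases (no β≰) (no α≰) = inj₂ (begin
    (2 + p) + (1 + p) * (3 + p)
      ≤⟨ +-mono-≤ (≰⇒> α≰) (≤-reflexive (sym (sum-const (1 + p) (3 + p)))) ⟩
    α + ∑[ j < 1 + p ] (3 + p)
      ≤⟨ +-monoʳ-≤ α (sum-mono-≤ λ j → ≤-trans (≰⇒> β≰) (proj₂ (argmin f′) j)) ⟩
    α + sum f′     ≡⟨ sum-remove {i = i₀} f ⟨
    sum f          ∎)

-- The retrieved number is m - 1. For a set `Y` of servers, either |Y| is at least this number, or
-- all the blocks and groups inside `Y` together number at most |Y|; both give Hall's condition.
C-TD-retrievable : ∀ p (D : TransversalDesign (2 + p) (3 + p)) →
                   Retrievable ((2 + p) + (1 + p) * (3 + p)) (C-TD D)
C-TD-retrievable p D i inj = hall-theorem (X (C-TD D) ∘ i) hall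
  where
  open TransversalDesign D
  open ≤-Reasoning
  hall : HallCondition (X (C-TD D) ∘ i)
  hall J Y cov = bound (weight-≤-sum p (trace D Y) (λ g → 𝟙 (group g ⊆? Y))
      (trace-≤ D Y) full (blocks-inside-≤ D Y))
    where
    full : ∀ g → 𝟙 (group g ⊆? Y) ≡ 0 ⊎ (𝟙 (group g ⊆? Y) ≡ 1 × trace D Y g ≡ 3 + p)
    full g with group g ⊆? Y
    ... | yes G⊆Y = inj₂ (refl , trace-full D G⊆Y)
    ... | no _    = inj₁ refl
    w = ∑[ j < #blocks ] 𝟙 (block j ⊆? Y)
    e = ∑[ g < 2 + p ] 𝟙 (group g ⊆? Y)
    bound : w + e ≤ sum (trace D Y) ⊎ (2 + p) + (1 + p) * (3 + p) ≤ sum (trace D Y) → ∣ J ∣ ≤ ∣ Y ∣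
    bound (inj₂ k≤) = begin
      ∣ J ∣             ≤⟨ ∣p∣≤n J ⟩
      _                 ≤⟨ k≤ ⟩
      sum (trace D Y)   ≡⟨ sum-trace D Y ⟩
      ∣ Y ∣             ∎
    bound (inj₁ w+e≤) = begin
      ∣ J ∣             ≡⟨ ∣∣≡sum J ⟩
      sum (λ j → 𝟙 (j ∈? J))
        ≤⟨ sum-mono-≤ (λ j → 𝟙-mono (j ∈? J) (X (C-TD D) (i j) ⊆? Y) (λ j∈J → cov j j∈J)) ⟩
      sum (λ j → 𝟙 (X (C-TD D) (i j) ⊆? Y))
        ≤⟨ sum-injective (λ t → 𝟙 (X (C-TD D) t ⊆? Y)) inj ⟩
      sum (λ t → 𝟙 (X (C-TD D) t ⊆? Y))
        ≡⟨ items-inside D Y ⟩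
      w + e             ≤⟨ w+e≤ ⟩
      sum (trace D Y)   ≡⟨ sum-trace D Y ⟩
      ∣ Y ∣             ∎

-- Lower bound on the storage

system : (Fin n → Subset m) → StorageSystem
system {n} {m} X = record { items = n ; servers = m ; X = X }

module _ {M n} (X : Fin n → Subset (2 + M)) (retrieve : Retrievable (suc M) (system X)) where

  avoids? : ∀ a j → Dec (a ∉ X j)
  avoids? a j = ¬? (a ∈? X j)

  -- If `suc M` items avoided `a` and `b`, the servers used to retrieve them, together with `a` and
  -- `b`, would be 3 + M distinct servers among 2 + M.
  few-avoid-pair : ∀ {a b} → a ≢ b → ∑[ j < n ] 𝟙 (avoids? a j ×-dec avoids? b j) ≤ M
  few-avoid-pair {a} {b} a≢b = ≮⇒≥ λ M< →
    let i , i-inj , avoid = sum≥⇒injection (λ j → avoids? a j ×-dec avoids? b j) M<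
        s , s-inj , s∈    = retrieve i i-inj
        s≢a : ∀ j → s j ≢ a
        s≢a j eq = proj₁ (avoid j) (subst (_∈ X (i j)) eq (s∈ j))
        s≢b : ∀ j → s j ≢ b
        s≢b j eq = proj₂ (avoid j) (subst (_∈ X (i j)) eq (s∈ j))
    in n≮n (2 + M) (Fin.injective⇒≤ (extend-injective s s-inj s≢a s≢b))
    where
    extend-injective : (s : Fin (suc M) → Fin (2 + M)) → Injective _≡_ _≡_ s →
                       (∀ j → s j ≢ a) → (∀ j → s j ≢ b) →
                       Injective _≡_ _≡_ (a F.∷ (b F.∷ s))
    extend-injective s inj s≢a s≢b {zero}        {zero}        _  = refl
    extend-injective s inj s≢a s≢b {zero}        {suc zero}    eq = contradiction eq a≢b
    extend-injective s inj s≢a s≢b {zero}        {suc (suc j)} eq = contradiction (sym eq) (s≢a j)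
    extend-injective s inj s≢a s≢b {suc zero}    {zero}        eq = contradiction (sym eq) a≢b
    extend-injective s inj s≢a s≢b {suc zero}    {suc zero}    _  = refl
    extend-injective s inj s≢a s≢b {suc zero}    {suc (suc j)} eq = contradiction (sym eq) (s≢b j)
    extend-injective s inj s≢a s≢b {suc (suc i)} {zero}        eq = contradiction eq (s≢a i)
    extend-injective s inj s≢a s≢b {suc (suc i)} {suc zero}    eq = contradiction eq (s≢b i)
    extend-injective s inj s≢a s≢b {suc (suc i)} {suc (suc j)} eq = cong (λ l → suc (suc l)) (inj eq)

  -- The number d_j = m - |X_j|, written as a sum over servers.
  avoided : Fin n → ℕ
  avoided j = ∑[ a < 2 + M ] 𝟙 (avoids? a j)

  ∣X∣+avoided : ∀ j → ∣ X j ∣ + avoided j ≡ 2 + M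
  ∣X∣+avoided j = begin
    ∣ X j ∣ + avoided j
      ≡⟨ cong (_+ avoided j) (∣∣≡sum (X j)) ⟩
    ∑[ a < 2 + M ] 𝟙 (a ∈? X j) + avoided j
      ≡⟨ ∑-distrib-+ (λ a → 𝟙 (a ∈? X j)) (λ a → 𝟙 (avoids? a j)) ⟨
    ∑[ a < 2 + M ] (𝟙 (a ∈? X j) + 𝟙 (avoids? a j))
      ≡⟨ sum-cong-≗ (λ a → 𝟙-¬ (a ∈? X j)) ⟩
    ∑[ a < 2 + M ] 1
      ≡⟨ trans (sum-const (2 + M) 1) (*-identityʳ (2 + M)) ⟩
    2 + M ∎
    where
    open ≡-Reasoning
    𝟙-¬ : (d : Dec P) → 𝟙 d + 𝟙 (¬? d) ≡ 1
    𝟙-¬ (yes _) = refl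
    𝟙-¬ (no _)  = refl

  -- The left side counts items with ordered pairs of servers they avoid. Equal pairs contribute
  -- `sum avoided`, and each of the (2 + M)(1 + M) pairs of distinct servers contributes at most
  -- `M`.
  sum-avoided² : ∑[ j < n ] (avoided j * avoided j) ≤ sum avoided + (2 + M) * (suc M * M)
  sum-avoided² = begin
    ∑[ j < n ] (avoided j * avoided j)
      ≡⟨ sum-cong-≗ (λ j → sum-*-sum (u j) (u j)) ⟩
    ∑[ j < n ] ∑[ a < 2 + M ] ∑[ b < 2 + M ] (u j a * u j b)
      ≡⟨ ∑-comm (λ j a → ∑[ b < 2 + M ] (u j a * u j b)) ⟩
    ∑[ a < 2 + M ] ∑[ j < n ] ∑[ b < 2 + M ] (u j a * u j b)
      ≡⟨ sum-cong-≗ (λ a → ∑-comm (λ j b → u j a * u j b)) ⟩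
    ∑[ a < 2 + M ] ∑[ b < 2 + M ] ∑[ j < n ] (u j a * u j b)
      ≤⟨ sum-mono-≤ row ⟩
    ∑[ a < 2 + M ] (∑[ j < n ] u j a + suc M * M)
      ≡⟨ ∑-distrib-+ (λ a → ∑[ j < n ] u j a) (λ _ → suc M * M) ⟩
    ∑[ a < 2 + M ] ∑[ j < n ] u j a + ∑[ a < 2 + M ] (suc M * M)
      ≡⟨ cong₂ _+_ (∑-comm (λ a j → u j a)) (sum-const (2 + M) (suc M * M)) ⟩
    sum avoided + (2 + M) * (suc M * M) ∎
    where
    open ≤-Reasoning
    u : Fin n → Fin (2 + M) → ℕ
    u j a = 𝟙 (avoids? a j)
    𝟙-idem : (d : Dec P) → 𝟙 d * 𝟙 d ≡ 𝟙 d
    𝟙-idem (yes _) = refl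
    𝟙-idem (no _)  = refl
    row : ∀ a → ∑[ b < 2 + M ] ∑[ j < n ] (u j a * u j b) ≤ ∑[ j < n ] u j a + suc M * M
    row a = begin
      ∑[ b < 2 + M ] ∑[ j < n ] (u j a * u j b)
        ≡⟨ sum-remove {i = a} (λ b → ∑[ j < n ] (u j a * u j b)) ⟩
      ∑[ j < n ] (u j a * u j a) + ∑[ b < suc M ] ∑[ j < n ] (u j a * u j (punchIn a b))
        ≤⟨ +-mono-≤ (≤-reflexive (sum-cong-≗ λ j → 𝟙-idem (avoids? a j)))
             (sum-mono-≤ λ b → ≤-trans
               (≤-reflexive (sum-cong-≗ λ j → sym (𝟙-× (avoids? a j) (avoids? (punchIn a b) j))))
               (few-avoid-pair λ eq → Fin.punchInᵢ≢i a b (sym eq))) ⟩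
      ∑[ j < n ] u j a + ∑[ b < suc M ] M
        ≡⟨ cong (∑[ j < n ] u j a +_) (sum-const (suc M) M) ⟩
      ∑[ j < n ] u j a + suc M * M ∎

  -- Tangent-line estimate: (d - D)(d - D - 1) ≥ 0 for integers d and D.
  tangent : ∀ D d → (1 + 2 * D) * d ≤ d * d + D * suc D
  tangent D d with ≤-total d D
  -- With `D` written as d + t, the product (d - D)(d - D - 1) is the natural number `t + t * t`.
  ... | inj₁ d≤D rewrite sym (m+[n∸m]≡n d≤D) = below (D ∸ d) d
    where
    below : ∀ t d → (1 + 2 * (d + t)) * d ≤ d * d + (d + t) * suc (d + t)
    below t d = m+n≤o⇒m≤o _ (≤-reflexive (eq t d))
      where
      eq : ∀ t d → (1 + 2 * (d + t)) * d + (t + t * t) ≡ d * d + (d + t) * (1 + (d + t))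
      eq = solve-∀
  ... | inj₂ D≤d rewrite sym (m+[n∸m]≡n D≤d) = above (d ∸ D)
    where
    above : ∀ t → (1 + 2 * D) * (D + t) ≤ (D + t) * (D + t) + D * suc D
    -- For d = D + t the slack is t(t - 1); the case of zero is separate so that the other is a
    -- polynomial over the naturals.
    above zero = ≤-reflexive (eq D)
      where
      eq : ∀ D → (1 + 2 * D) * (D + 0) ≡ (D + 0) * (D + 0) + D * (1 + D)
      eq = solve-∀
    above (suc t) = m+n≤o⇒m≤o _ (≤-reflexive (eq t D))
      where
      eq : ∀ t D → (1 + 2 * D) * (D + (1 + t)) + (t + t * t) ≡
                   (D + (1 + t)) * (D + (1 + t)) + D * (1 + D)
      eq = solve-∀

  -- Summing `tangent` over the items and inserting `sum-avoided²` bounds 2D Σ d_j, and Σ d_j is nm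
  -- minus the storage. All terms are kept additive to avoid truncated subtraction.
  storage-bound : ∀ D → 2 * D * (n * (2 + M)) ≤
    2 * D * (∑[ j < n ] ∣ X j ∣) + ((2 + M) * (suc M * M) + n * (D * suc D))
  storage-bound D = begin
    2 * D * (n * (2 + M))                      ≡⟨ cong (2 * D *_) (sum-const n (2 + M)) ⟨
    2 * D * (∑[ j < n ] (2 + M))               ≡⟨ cong (2 * D *_) (sum-cong-≗ ∣X∣+avoided) ⟨
    2 * D * (∑[ j < n ] (∣ X j ∣ + avoided j)) ≡⟨ cong (2 * D *_) (∑-distrib-+ (∣_∣ ∘ X) avoided) ⟩
    2 * D * (N + A)                            ≡⟨ *-distribˡ-+ (2 * D) N A ⟩
    2 * D * N + 2 * D * A                      ≤⟨ +-monoʳ-≤ (2 * D * N) (+-cancelˡ-≤ A _ _ sum-tangent) ⟩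
    2 * D * N + ((2 + M) * (suc M * M) + n * (D * suc D)) ∎
    where
    open ≤-Reasoning
    N = ∑[ j < n ] ∣ X j ∣
    A = sum avoided
    sum-tangent : A + 2 * D * A ≤ A + ((2 + M) * (suc M * M) + n * (D * suc D))
    sum-tangent = begin
      (1 + 2 * D) * A                                   ≡⟨ *-distribˡ-sum (1 + 2 * D) avoided ⟩
      ∑[ j < n ] ((1 + 2 * D) * avoided j)              ≤⟨ sum-mono-≤ (λ j → tangent D (avoided j)) ⟩
      ∑[ j < n ] (avoided j * avoided j + D * suc D)
        ≡⟨ ∑-distrib-+ (λ j → avoided j * avoided j) (λ _ → D * suc D) ⟩
      ∑[ j < n ] (avoided j * avoided j) + ∑[ j < n ] (D * suc D)
        ≤⟨ +-mono-≤ sum-avoided² (≤-reflexive (sum-const n (D * suc D))) ⟩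
      A + (2 + M) * (suc M * M) + n * (D * suc D)       ≡⟨ +-assoc A _ _ ⟩
      A + ((2 + M) * (suc M * M) + n * (D * suc D))     ∎

-- The choice D = m − q = q (q − 2) makes the storage bound exact.
minimal-storage : ∀ p (S : StorageSystem) →
  let q = 3 + p in
  items S ≡ q * q + (2 + p) → servers S ≡ 2 + (1 + p) * (4 + p) →
  Retrievable (suc ((1 + p) * (4 + p))) S → (2 + p) * (3 + p) * (4 + p) ≤ storage S
minimal-storage p record { X = X } refl refl retrieve =
  *-cancelˡ-≤ (2 * D) (+-cancelʳ-≤ rest _ _ (begin
    2 * D * ((2 + p) * (3 + p) * (4 + p)) + rest    ≡⟨ exact p ⟩
    2 * D * (b * (2 + M))                           ≤⟨ storage-bound X retrieve D ⟩
    2 * D * (∑[ j < b ] ∣ X j ∣) + rest             ∎))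
  where
  open ≤-Reasoning
  D = (3 + p) * (1 + p)
  M = (1 + p) * (4 + p)
  b = (3 + p) * (3 + p) + (2 + p)
  rest = (2 + M) * (suc M * M) + b * (D * suc D)
  exact : ∀ p → let D = (3 + p) * (1 + p) ; M = (1 + p) * (4 + p) ; b = (3 + p) * (3 + p) + (2 + p) in
    2 * D * ((2 + p) * (3 + p) * (4 + p)) + ((2 + M) * ((1 + M) * M) + b * (D * (1 + D))) ≡
    2 * D * (b * (2 + M))
  exact = solve-∀

-- Binomial coefficients

[k+r]Ck*k!*r! : ∀ k r → ((k + r) C k) * (k ! * r !) ≡ (k + r) !
[k+r]Ck*k!*r! k r = begin
  ((k + r) C k) * (k ! * r !)
    ≡⟨ cong (λ l → ((k + r) C k) * (k ! * l !)) (m+n∸m≡n k r) ⟨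
  ((k + r) C k) * (k ! * (k + r ∸ k) !)
    ≡⟨ cong (_* (k ! * (k + r ∸ k) !)) (nCk≡n!/k![n-k]! (m≤m+n k r)) ⟩
  _ ≡⟨ m/n*n≡m (k![n∸k]!∣n! (m≤m+n k r)) ⟩
  (k + r) ! ∎
  where
  open ≡-Reasoning
  instance _ = k !* (k + r ∸ k) !≢0

-- Multiplied by k! r!, both sides become (2 + l)!. Since m = (k - 1) + 2 in the code, this removes
-- the binomial coefficients from the ratio in the lower bound.
[2+l]Ck : ∀ k r → let l = k + r in
  ((2 + l) C k) * ((2 + r) * (1 + r)) ≡ (2 + l) * (1 + l) * (l C k)
[2+l]Ck k r = *-cancelʳ-≡ _ _ (k ! * r !) {{k !* r !≢0}} (begin
  ((2 + l) C k) * ((2 + r) * (1 + r)) * (k ! * r !)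
    ≡⟨ shuffle ((2 + l) C k) (2 + r) (1 + r) (k !) (r !) ⟩
  ((2 + l) C k) * (k ! * ((2 + r) * ((1 + r) * r !)))
    ≡⟨ subst (λ j → (j C k) * (k ! * (2 + r) !) ≡ j !) (trans (+-suc k (suc r)) (cong suc (+-suc k r)))
             ([k+r]Ck*k!*r! k (2 + r)) ⟩
  (2 + l) * ((1 + l) * l !)
    ≡⟨ *-assoc (2 + l) (1 + l) (l !) ⟨
  (2 + l) * (1 + l) * l !
    ≡⟨ cong ((2 + l) * (1 + l) *_) ([k+r]Ck*k!*r! k r) ⟨
  (2 + l) * (1 + l) * ((l C k) * (k ! * r !))
    ≡⟨ *-assoc ((2 + l) * (1 + l)) (l C k) (k ! * r !) ⟨
  (2 + l) * (1 + l) * (l C k) * (k ! * r !) ∎)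
  where
  open ≡-Reasoning
  l = k + r
  shuffle : ∀ c x y a b → c * (x * y) * (a * b) ≡ c * (a * (x * (y * b)))
  shuffle = solve-∀

-- Rational numbers

-- Opened only here: the prefix +_ makes the sections and chains above ambiguous.
open import Data.Integer.Base using (+_)

-- The fraction `i / suc d` is reduced to lowest terms; passing to the unreduced fraction turns
-- comparisons into cross-multiplication.
toℚᵘ-/ : ∀ i d → toℚᵘ (i / suc d) ℚᵘ.≃ mkℚᵘ i d
toℚᵘ-/ i d = ℚ.toℚᵘ-fromℚᵘ (mkℚᵘ i d)

n≤a/d⁺ : ∀ n a d .{{_ : NonZero d}} → n * d ≤ a → (+ n / 1) ℚ.≤ (+ a / d)
n≤a/d⁺ n a (suc d) nd≤a = ℚ.toℚᵘ-cancel-≤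
  (ℚᵘ.≤-respˡ-≃ (ℚᵘ.≃-sym (toℚᵘ-/ (+ n) 0)) (ℚᵘ.≤-respʳ-≃ (ℚᵘ.≃-sym (toℚᵘ-/ (+ a) d))
    (*≤* (subst₂ ℤ._≤_ (ℤ.pos-* n (suc d)) (sym (ℤ.*-identityʳ (+ a))) (ℤ.+≤+ nd≤a)))))

n≤a/d⁻ : ∀ n a d .{{_ : NonZero d}} → (+ n / 1) ℚ.≤ (+ a / d) → n * d ≤ a
n≤a/d⁻ n a (suc d) n≤ with
  ℚᵘ.≤-respˡ-≃ (toℚᵘ-/ (+ n) 0) (ℚᵘ.≤-respʳ-≃ (toℚᵘ-/ (+ a) d) (ℚ.toℚᵘ-mono-≤ n≤))
... | *≤* le = ℤ.drop‿+≤+ (subst₂ ℤ._≤_ (sym (ℤ.pos-* n (suc d))) (ℤ.*-identityʳ (+ a)) le)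

[m+n]-m : ∀ m n → + (m + n) ℤ.- + m ≡ + n
[m+n]-m m n = trans (ℤ.m-n≡m⊖n (m + n) m)
                    (trans (ℤ.⊖-≥ (m≤m+n m n)) (cong +_ (m+n∸m≡n m n)))

-- `floor` computes on a concrete normalised rational, so `x` is first identified with c over 1.
floor-≃ : ∀ {x} c → toℚᵘ x ℚᵘ.≃ mkℚᵘ (+ c) 0 → floor x ≡ + c
floor-≃ {x} c x≃c = trans (cong floor x≡c) (trans (ℤ.*-identityˡ _) (cong +_ (n/1≡n c)))
  where
  x≡c : x ≡ mkℚ (+ c) 0 (Coprimality.sym (Coprimality.1-coprimeTo c))
  x≡c = ℚ.toℚᵘ-injective x≃c

-- The hypothesis is u(a/b - n)/(d + 1) = c with denominators cleared: the argument of `floor` is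
-- already an integer.
floor-bound : ∀ u a n c b .{{_ : NonZero b}} d → u * a ≡ (u * n + c * suc d) * b →
  floor ((+ u / 1) ℚ.* ((+ a / b) ℚ.- (+ n / 1)) ℚ.* (+ 1 / suc d)) ≡ + c
floor-bound u a n c (suc b) d eq = floor-≃ c (begin
  toℚᵘ (U ℚ.* (A ℚ.- N) ℚ.* E)
    ≈⟨ ℚ.toℚᵘ-homo-* (U ℚ.* (A ℚ.- N)) E ⟩
  toℚᵘ (U ℚ.* (A ℚ.- N)) ℚᵘ.* toℚᵘ E
    ≈⟨ ℚᵘ.*-congʳ (ℚ.toℚᵘ-homo-* U (A ℚ.- N)) ⟩
  toℚᵘ U ℚᵘ.* toℚᵘ (A ℚ.- N) ℚᵘ.* toℚᵘ E
    ≈⟨ ℚᵘ.*-congʳ (ℚᵘ.*-congˡ {toℚᵘ U} (ℚ.toℚᵘ-homo-+ A (ℚ.- N))) ⟩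
  toℚᵘ U ℚᵘ.* (toℚᵘ A ℚᵘ.+ toℚᵘ (ℚ.- N)) ℚᵘ.* toℚᵘ E
    ≈⟨ ℚᵘ.*-cong
         (ℚᵘ.*-cong (toℚᵘ-/ (+ u) 0)
           (ℚᵘ.+-cong (toℚᵘ-/ (+ a) b)
             (ℚᵘ.≃-trans (ℚ.toℚᵘ-homo‿- N) (ℚᵘ.-‿cong (toℚᵘ-/ (+ n) 0)))))
         (toℚᵘ-/ (+ 1) d) ⟩
  mkℚᵘ (+ u) 0 ℚᵘ.* (mkℚᵘ (+ a) b ℚᵘ.- mkℚᵘ (+ n) 0) ℚᵘ.* mkℚᵘ (+ 1) d
    ≈⟨ *≡* cross ⟩
  mkℚᵘ (+ c) 0 ∎)
  where
  open import Relation.Binary.Reasoning.Setoid ℚᵘ.≃-setoid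
  U = + u / 1
  A = + a / suc b
  N = + n / 1
  E = + 1 / suc d
  eqℤ : + u ℤ.* + a ≡ (+ u ℤ.* + n ℤ.+ + c ℤ.* + suc d) ℤ.* + suc b
  eqℤ = trans (sym (ℤ.pos-* u a)) (trans (cong +_ eq) (trans (ℤ.pos-* (u * n + c * suc d) (suc b))
    (cong (ℤ._* + suc b) (trans (ℤ.pos-+ (u * n) (c * suc d))
      (cong₂ ℤ._+_ (ℤ.pos-* u n) (ℤ.pos-* c (suc d)))))))
  expand : ∀ u a n b → (u ℤ.* (a ℤ.* + 1 ℤ.+ (ℤ.- n) ℤ.* b)) ℤ.* + 1 ℤ.* + 1 ≡
                       u ℤ.* a ℤ.- u ℤ.* n ℤ.* b
  expand = ℤSolver.solve-∀
  collapse : ∀ un c d b → (un ℤ.+ c ℤ.* d) ℤ.* b ℤ.- un ℤ.* b ≡ c ℤ.* (+ 1 ℤ.* (b ℤ.* + 1) ℤ.* d)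
  collapse = ℤSolver.solve-∀
  denominators : + 1 ℤ.* (+ suc b ℤ.* + 1) ℤ.* + suc d ≡ + (1 * (suc b * 1) * suc d)
  denominators = trans (cong (ℤ._* + suc d)
      (trans (cong (+ 1 ℤ.*_) (sym (ℤ.pos-* (suc b) 1))) (sym (ℤ.pos-* 1 (suc b * 1)))))
    (sym (ℤ.pos-* (1 * (suc b * 1)) (suc d)))
  cross : (+ u ℤ.* (+ a ℤ.* + 1 ℤ.+ (ℤ.- + n) ℤ.* + suc b)) ℤ.* + 1 ℤ.* + 1 ≡
          + c ℤ.* + (1 * (suc b * 1) * suc d)
  cross = trans (expand (+ u) (+ a) (+ n) (+ suc b))
    (trans (cong (ℤ._- + u ℤ.* + n ℤ.* + suc b) eqℤ)
      (trans (collapse (+ u ℤ.* + n) (+ c) (+ suc d) (+ suc b)) (cong (+ c ℤ.*_) denominators)))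

-- The lower bound

-- By `[2+l]Ck` the ratio equals M(2 + M)(1 + M)/((2 + r)(1 + r)), so admissibility yields a
-- polynomial inequality.
admissible⇒ : ∀ {M n t} → IsAdmissible n (suc M) (2 + M) t →
  let r = M ∸ t in n * ((2 + r) * (1 + r)) ≤ M * ((2 + M) * (1 + M))
admissible⇒ {M} {n} {t} (_ , t≤M , n≤ratio) =
  *-cancelʳ-≤ _ _ b {{C-nonZero t≤M}} (begin
    n * v * b                                 ≡⟨ swap n v b ⟩
    n * b * v                                 ≤⟨ *-monoˡ-≤ v (n≤a/d⁻ n (M * ((2 + M) C t)) b {{C-nonZero t≤M}} n≤ratio) ⟩
    M * ((2 + M) C t) * v                     ≡⟨ *-assoc M ((2 + M) C t) v ⟩
    M * (((2 + M) C t) * v)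
      ≡⟨ cong (M *_) (subst (λ l → ((2 + l) C t) * v ≡ (2 + l) * (1 + l) * (l C t))
                            (m+[n∸m]≡n t≤M) ([2+l]Ck t (M ∸ t))) ⟩
    M * ((2 + M) * (1 + M) * b)               ≡⟨ *-assoc M ((2 + M) * (1 + M)) b ⟨
    M * ((2 + M) * (1 + M)) * b               ∎)
  where
  open ≤-Reasoning
  b = M C t
  v = (2 + (M ∸ t)) * (1 + (M ∸ t))
  swap : ∀ x y z → x * y * z ≡ x * z * y
  swap = solve-∀

-- Here u is k - s, c is the value of the floor, and the factor 2 is m - k + 1.
lowerBound-exact : ∀ {M s n u c N} (s≤M : s ≤ M) → suc M ≡ s + u →
  u * (M * ((2 + M) C s)) ≡ (u * n + c * 2) * (M C s) → n * s ≡ c + N →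
  + N ≡ lowerBound n (suc M) (2 + M) s s≤M
lowerBound-exact {M} {s} {n} {u} {c} {N} s≤M k≡s+u ratio ns≡c+N = sym (begin
  + (n * s) ℤ.- floor (expression (+ suc M ℤ.- + s) (suc M ∸ M))
    ≡⟨ cong₂ (λ i d → + (n * s) ℤ.- floor (expression i d))
         (trans (cong (λ k → + k ℤ.- + s) k≡s+u) ([m+n]-m s u)) (m+n∸n≡m 1 M) ⟩
  + (n * s) ℤ.- floor (expression (+ u) 1)
    ≡⟨ cong₂ (λ x y → + x ℤ.- y) ns≡c+N (floor-bound u (M * ((2 + M) C s)) n c (M C s) {{C-nonZero s≤M}} 1 ratio) ⟩
  + (c + N) ℤ.- + c
    ≡⟨ [m+n]-m c N ⟩
  + N ∎)
  where
  open ≡-Reasoning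
  expression : ℤ → ℕ → ℚ
  expression i d =
    (i / 1) ℚ.* (binomialRatio (suc M) (2 + M) s s≤M ℚ.- (+ n / 1)) ℚ.* (+ 1 / suc d)

-- The parameters of the code for q = 3 + p

module Parameters (p : ℕ) where

  -- `M` is both k - 1 and m - 2, and `r` is M - q. As polynomials in `p` with natural coefficients
  -- they are within reach of the ring solver.
  q #items M #retrieved #servers #stored r : ℕ
  q = 3 + p
  #items = q * q + (2 + p)
  M = (1 + p) * (4 + p)
  #retrieved = suc M
  #servers = 2 + M
  #stored = (2 + p) * (3 + p) * (4 + p)
  r = p * p + 4 * p + 1

  M≡q+r : M ≡ q + r
  M≡q+r = eq p
    where
    eq : ∀ p → (1 + p) * (4 + p) ≡ 3 + p + (p * p + 4 * p + 1)
    eq = solve-∀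

  q≤M : q ≤ M
  q≤M = subst (q ≤_) (sym M≡q+r) (m≤m+n q r)

  -- With 1 + r = k - q, this says that (k - q) times the excess of the binomial ratio over n is
  -- 2q²; dividing by m - k + 1 = 2 gives exactly q².
  ratio : (1 + r) * (M * (#servers C q)) ≡ ((1 + r) * #items + q * q * 2) * (M C q)
  ratio = *-cancelˡ-≡ _ _ (2 + r) (begin
    (2 + r) * ((1 + r) * (M * (#servers C q)))
      ≡⟨ shuffle (2 + r) (1 + r) M (#servers C q) ⟩
    M * ((#servers C q) * ((2 + r) * (1 + r)))
      ≡⟨ cong (M *_) (subst (λ l → ((2 + l) C q) * ((2 + r) * (1 + r)) ≡ (2 + l) * (1 + l) * (l C q))
                            (sym M≡q+r) ([2+l]Ck q r)) ⟩
    M * ((2 + M) * (1 + M) * (M C q))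
      ≡⟨ *-assoc M ((2 + M) * (1 + M)) (M C q) ⟨
    M * ((2 + M) * (1 + M)) * (M C q)
      ≡⟨ cong (_* (M C q)) (eq p) ⟩
    (2 + r) * ((1 + r) * #items + q * q * 2) * (M C q)
      ≡⟨ *-assoc (2 + r) ((1 + r) * #items + q * q * 2) (M C q) ⟩
    (2 + r) * (((1 + r) * #items + q * q * 2) * (M C q)) ∎)
    where
    open ≡-Reasoning
    shuffle : ∀ x y z c → x * (y * (z * c)) ≡ z * (c * (x * y))
    shuffle = solve-∀
    eq : ∀ p → let q = 3 + p ; M = (1 + p) * (4 + p) ; r = p * p + 4 * p + 1 in
      M * ((2 + M) * (1 + M)) ≡ (2 + r) * ((1 + r) * (q * q + (2 + p)) + q * q * 2)
    eq = solve-∀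

  q-admissible : IsAdmissible #items #retrieved #servers q
  q-admissible = s≤s z≤n , q≤M ,
    n≤a/d⁺ #items (M * (#servers C q)) (M C q) {{C-nonZero q≤M}} (*-cancelˡ-≤ (1 + r) (begin
      (1 + r) * (#items * (M C q))               ≡⟨ *-assoc (1 + r) #items (M C q) ⟨
      (1 + r) * #items * (M C q)
        -- The excess 2q² in `ratio` is nonnegative.
        ≤⟨ *-monoˡ-≤ (M C q) (m≤m+n ((1 + r) * #items) (q * q * 2)) ⟩
      ((1 + r) * #items + q * q * 2) * (M C q)   ≡⟨ ratio ⟨
      (1 + r) * (M * (#servers C q))             ∎))
    where
    open ≤-Reasoning

  -- For t < q the number M - t is at least 1 + r, so `admissible⇒` would give n(3 + r)(2 + r) ≤ M(2
  -- + M)(1 + M); the left side is larger by 2(q - 2)(q - 1)q.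
  q-least : ∀ t → IsAdmissible #items #retrieved #servers t → q ≤ t
  q-least t adm = ≮⇒≥ λ t<q → n≮n (M * ((2 + M) * (1 + M))) (begin-strict
    M * ((2 + M) * (1 + M))
      <⟨ m<m+n _ (s≤s z≤n) ⟩
    M * ((2 + M) * (1 + M)) + 2 * ((1 + p) * (2 + p) * (3 + p))
      ≡⟨ eq p ⟩
    #items * ((3 + r) * (2 + r))
      ≤⟨ *-monoʳ-≤ #items (*-mono-≤ (s≤s (s≤s (r<M∸t t<q))) (s≤s (r<M∸t t<q))) ⟩
    #items * ((2 + (M ∸ t)) * (1 + (M ∸ t)))
      ≤⟨ admissible⇒ {M} {#items} {t} adm ⟩
    M * ((2 + M) * (1 + M)) ∎)
    where
    open ≤-Reasoning
    r<M∸t : t < q → r < M ∸ t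
    r<M∸t t<q = begin
      1 + r                          ≡⟨ m+n∸m≡n (2 + p) (1 + r) ⟨
      (2 + p) + (1 + r) ∸ (2 + p)    ≡⟨ cong (_∸ (2 + p)) (trans (+-suc (2 + p) r) (sym M≡q+r)) ⟩
      M ∸ (2 + p)                    ≤⟨ ∸-monoʳ-≤ M (s≤s⁻¹ t<q) ⟩
      M ∸ t                          ∎
    eq : ∀ p → let q = 3 + p ; M = (1 + p) * (4 + p) ; r = p * p + 4 * p + 1 in
      M * ((2 + M) * (1 + M)) + 2 * ((1 + p) * (2 + p) * (3 + p)) ≡
      (q * q + (2 + p)) * ((3 + r) * (2 + r))
    eq = solve-∀

  N-attains-bound : + #stored ≡ lowerBound #items #retrieved #servers q q≤M
  -- The floor is q², and nq = q² + (q³ - q).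
  N-attains-bound = lowerBound-exact {n = #items} {u = 1 + r} {c = q * q} q≤M
    (trans (cong suc M≡q+r) (sym (+-suc q r))) ratio (eq p)
    where
    eq : ∀ p → ((3 + p) * (3 + p) + (2 + p)) * (3 + p) ≡
               (3 + p) * (3 + p) + (2 + p) * (3 + p) * (4 + p)
    eq = solve-∀

  module _ (D : TransversalDesign (2 + p) q) where
    open TransversalDesign D

    #blocks≡q² : #blocks ≡ q * q
    #blocks≡q² = #blocks≡h*h D {zero} {suc zero} λ ()

    C-TD-isCBC : IsCBC #items #stored #retrieved #servers (C-TD D)
    C-TD-isCBC = record
      { items≡n     = cong (_+ (2 + p)) #blocks≡q²
      ; storage≡N   = trans (storage-C-TD D)
                            (trans (cong (λ b → b * (2 + p) + (2 + p) * q) #blocks≡q²) (storage-eq p))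
      ; retrievable = subst (λ l → Retrievable l (C-TD D)) (k-eq p) (C-TD-retrievable p D)
      ; servers≡m   = servers-eq p
      }
      where
      storage-eq : ∀ p → (3 + p) * (3 + p) * (2 + p) + (2 + p) * (3 + p) ≡ (2 + p) * (3 + p) * (4 + p)
      storage-eq = solve-∀
      k-eq : ∀ p → (2 + p) + (1 + p) * (3 + p) ≡ 1 + (1 + p) * (4 + p)
      k-eq = solve-∀
      servers-eq : ∀ p → (2 + p) * (3 + p) ≡ 2 + (1 + p) * (4 + p)
      servers-eq = solve-∀

    C-TD-optimal : IsOptimalCBC #items #stored #retrieved #servers (C-TD D)
    C-TD-optimal = C-TD-isCBC , (C-TD D , C-TD-isCBC) , λ _ S cbc →
      subst (#stored ≤_) (IsCBC.storage≡N cbc)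
        (minimal-storage p S (IsCBC.items≡n cbc) (IsCBC.servers≡m cbc) (IsCBC.retrievable cbc))

  -- Variable parameters let the equations be matched with `refl`, carrying all conclusions at once,
  -- including the dependent pair, from the polynomial forms to those with truncated subtraction.
  optimal-and-exact : ∀ {n′ N′ k′ m′} (D : TransversalDesign (2 + p) q) →
    #items ≡ n′ → #stored ≡ N′ → #retrieved ≡ k′ → #servers ≡ m′ →
    IsOptimalCBC n′ N′ k′ m′ (C-TD D) × IsLeastAdmissible n′ k′ m′ q ×
    (Σ[ q≤k-1 ∈ q ≤ k′ ∸ 1 ] + N′ ≡ lowerBound n′ k′ m′ q q≤k-1)
  optimal-and-exact D refl refl refl refl =
    C-TD-optimal D , (q-admissible , q-least) , q≤M , N-attains-bound

  #items≡ : #items ≡ q ^ 2 + q ∸ 1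
  #items≡ = cong (_∸ 1) (eq p)
    where
    eq : ∀ p → 1 + ((3 + p) * (3 + p) + (2 + p)) ≡ (3 + p) * ((3 + p) * 1) + (3 + p)
    eq = solve-∀

  #stored≡ : #stored ≡ q ^ 3 ∸ q
  #stored≡ = trans (sym (m+n∸n≡m #stored q)) (cong (_∸ q) (eq p))
    where
    eq : ∀ p → (2 + p) * (3 + p) * (4 + p) + (3 + p) ≡ (3 + p) * ((3 + p) * ((3 + p) * 1))
    eq = solve-∀

  #servers≡ : #servers ≡ q ^ 2 ∸ q
  #servers≡ = trans (sym (m+n∸n≡m #servers q)) (cong (_∸ q) (eq p))
    where
    eq : ∀ p → 2 + (1 + p) * (4 + p) + (3 + p) ≡ (3 + p) * ((3 + p) * 1)
    eq = solve-∀

theorem13 :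
    (q : ℕ) → 3 ≤ q → IsPrimePower q →
    (D : TransversalDesign (q ∸ 1) q) → Resolvable D →
    let n = q ^ 2 + q ∸ 1
        N = q ^ 3 ∸ q
        k = q ^ 2 ∸ q ∸ 1
        m = q ^ 2 ∸ q
    in
      IsOptimalCBC n N k m (C-TD D)
      × IsLeastAdmissible n k m q
      × (Σ[ q≤k-1 ∈ q ≤ k ∸ 1 ] + N ≡ lowerBound n k m q q≤k-1)
theorem13 (suc (suc (suc p))) (s≤s (s≤s (s≤s z≤n))) _ D _ =
  optimal-and-exact D #items≡ #stored≡ (cong (_∸ 1) #servers≡) #servers≡
  where
  open Parameters p
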